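{- Let $(\mathcal{C},\mathcal{M})$ be a weak adhesive HLR category. Let $\rho_1$ and $\rho_2$ be $\mathcal{M}$-weak spans in $\mathcal{C}$ that have a coproduct $\rho_1+\rho_2$, let $G$ and $H'$ be objects of $\mathcal{C}$, and let $\gamma_1\in\Delta(G,\rho_1)$ and $\gamma_2\in\Delta(G,\rho_2)$ be parallel independent direct transformations. If there is a parallel coherent transformation of $G$ by $\gamma_1,\gamma_2$ with result $H'$ (written $G\Rightarrow_{\{\gamma_1,\gamma_2\}}H'$), then there is a coproduct $\gamma_1+\gamma_2$ of the direct transformations $\gamma_1$ and $\gamma_2$ with result $H'$ (written $G\Rightarrow_{\gamma_1+\gamma_2}H'$).
   Context: Weak adhesive HLR category: a category $\mathcal{C}$ with a class $\mathcal{M}$ of monomorphisms such that (1) $\mathcal{M}$ contains all isomorphisms, is closed under composition, and under decomposition ($g\circ f\in\mathcal{M}$ and $g\in\mathcal{M}$ imply $f\in\mathcal{M}$); (2) $\mathcal{C}$ has pushouts and pullbacks along $\mathcal{M}$-morphisms, and $\mathcal{M}$ is stable under pushouts and pullbacks; (3) pushouts along $\mathcal{M}$-morphisms are weak van Kampen squares: given a pushout of $m:A\to B$, $f:A\to C$ with $m\in\mathcal{M}$ and pushout object $D$, and any commutative cube with this square as bottom face, vertical morphisms $a:A'\to A$, $b:B'\to B$, $c:C'\to C$, $d:D'\to D$, whose two back faces (those containing $a$) are pullbacks, and such that $f\in\mathcal{M}$ or $b,c,d\in\mathcal{M}$, the top face is a pushout if and only if the two front faces are pullbacks. Weak spans: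 a weak span $\rho$ is a diagram $L\xleftarrow{l}K\xleftarrow{i}I\xrightarrow{r}R$ in $\mathcal{C}$; it is an $\mathcal{M}$-weak span if $l,i,r\in\mathcal{M}$. For an object $G$, a direct transformation $\gamma$ of $G$ by $\rho$, with result $H$, consists of $\rho$ together with objects $D,H$ and morphisms $m:L\to G$, $k:K\to D$, $f:D\to G$, $g:D\to H$, $n:R\to H$ such that $(G,f,m)$ is a pushout of $(l,k)$ (with $m\circ l=f\circ k$) and $(H,g,n)$ is a pushout of $(r,k\circ i)$ (with $n\circ r=g\circ k\circ i$). $\Delta(G,\rho)$ is the set of direct transformations of $G$ by $\rho$. The data of $\rho_a$ and $\gamma_a$ are denoted by the same letters indexed by $a$. Parallel independence: $\gamma_1,\gamma_2$ are parallel independent if there exist morphisms $j_1:L_1\to D_2$ and $j_2:L_2\to D_1$ with $f_2\circ j_1=m_1$ and $f_1\circ j_2=m_2$. Parallel coherence: $\gamma_1,\gamma_2$ are parallel coherent if there exist $j_1^2:I_1\to D_2$ and $j_2^1:I_2\to D_1$ with $f_2\circ j_1^2=f_1\circ k_1\circ i_1$ and $f_1\circ j_2^1=f_2\circ k_2\circ i_2$. (Parallel independent implies parallel coherent, via $j_1\circ l_1\circ i_1$ and $j_2\circ l_2\circ i_2$.) Parallel coherent transformation of $G$ by a parallel coherent pair $\gamma_1,\gamma_2$, with result $H'$: with morphisms $j_1^2:I_1\to D_2$ and $j_2^1:I_2\to D_1$ satisfying $f_2\circ j_1^2=f_1\circ k_1\circ i_1$ and $f_1\circ j_2^1=f_2\circ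 k_2\circ i_2$, and with $j_a^a=k_a\circ i_a$ for $a=1,2$, it consists of a pullback $(D',e_1,e_2)$ of $(f_1,f_2)$ with $e_a:D'\to D_a$; for $c=1,2$ the unique morphism $d_c:I_c\to D'$ with $e_a\circ d_c=j_c^a$ for $a=1,2$; for $a=1,2$ a pushout $(H'_a,g'_a,n'_a)$ of $(r_a,d_a)$, with $g'_a:D'\to H'_a$, $n'_a:R_a\to H'_a$; and a pushout $(H',h_1,h_2)$ of $(g'_1,g'_2)$. Coproducts: the coproduct of weak spans $\rho_1,\rho_2$ is the weak span $L_1+L_2\xleftarrow{l_1+l_2}K_1+K_2\xleftarrow{i_1+i_2}I_1+I_2\xrightarrow{r_1+r_2}R_1+R_2$ (it exists when these four binary coproducts exist in $\mathcal{C}$). A coproduct $\gamma_1+\gamma_2$ of $\gamma_1$ and $\gamma_2$ is a direct transformation of $G$ by $\rho_1+\rho_2$ whose morphism $L_1+L_2\to G$ is the copairing of $m_1$ and $m_2$. -}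

module Defs where

open import Level using (Level; _⊔_; suc)
open import Data.Product using (Σ; ∃; _×_)
open import Data.Sum using (_⊎_)
open import Function.Bundles using (_⇔_)
open import Relation.Binary.Structures using (IsEquivalence)

-- Equality of parallel morphisms is an equivalence relation ≈ that composition
-- respects; every statement about equality of morphisms is stated with ≈.
-- Objects are never compared for equality.
record Category (o ℓ e : Level) : Set (suc (o ⊔ ℓ ⊔ e)) where
  infix  4 _≈_ _⇒_
  infixr 9 _∘_
  field
    Obj : Set o
    _⇒_ : Obj → Obj → Set ℓ
    _≈_ : ∀ {A B} → A ⇒ B → A ⇒ B → Set e
    id  : ∀ {A} → A ⇒ A
    _∘_ : ∀ {A B C} → B ⇒ C → A ⇒ B → A ⇒ C
    equiv     : ∀ {A B} → IsEquivalence (_≈_ {A} {B})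
    ∘-resp-≈  : ∀ {A B C} {f h : B ⇒ C} {g i : A ⇒ B} →
                f ≈ h → g ≈ i → f ∘ g ≈ h ∘ i
    assoc     : ∀ {A B C D} {f : A ⇒ B} {g : B ⇒ C} {h : C ⇒ D} →
                (h ∘ g) ∘ f ≈ h ∘ (g ∘ f)
    identityˡ : ∀ {A B} {f : A ⇒ B} → id ∘ f ≈ f
    identityʳ : ∀ {A B} {f : A ⇒ B} → f ∘ id ≈ f

module _ {o ℓ e : Level} (𝒞 : Category o ℓ e) where
  open Category 𝒞

  Mono : ∀ {A B} → A ⇒ B → Set (o ⊔ ℓ ⊔ e)
  Mono {A} f = ∀ {X} (g h : X ⇒ A) → f ∘ g ≈ f ∘ h → g ≈ h

  IsIso : ∀ {A B} → A ⇒ B → Set (ℓ ⊔ e)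
  IsIso {A} {B} f = Σ (B ⇒ A) λ g → (g ∘ f ≈ id) × (f ∘ g ≈ id)

  -- In IsPushout f g p q the span is (f , g) and the cospan (p , q):
  --
  --        f
  --    A ----> B
  --  g |       | p
  --    v       v
  --    C ----> D
  --        q
  record IsPushout {A B C D} (f : A ⇒ B) (g : A ⇒ C)
                   (p : B ⇒ D) (q : C ⇒ D) : Set (o ⊔ ℓ ⊔ e) where
    field
      commute   : p ∘ f ≈ q ∘ g
      universal : ∀ {X} (h₁ : B ⇒ X) (h₂ : C ⇒ X) → h₁ ∘ f ≈ h₂ ∘ g → D ⇒ X
      factor₁   : ∀ {X} {h₁ : B ⇒ X} {h₂ : C ⇒ X} (eq : h₁ ∘ f ≈ h₂ ∘ g) →
                  universal h₁ h₂ eq ∘ p ≈ h₁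
      factor₂   : ∀ {X} {h₁ : B ⇒ X} {h₂ : C ⇒ X} (eq : h₁ ∘ f ≈ h₂ ∘ g) →
                  universal h₁ h₂ eq ∘ q ≈ h₂
      unique    : ∀ {X} {h₁ : B ⇒ X} {h₂ : C ⇒ X} (eq : h₁ ∘ f ≈ h₂ ∘ g) {u : D ⇒ X} →
                  u ∘ p ≈ h₁ → u ∘ q ≈ h₂ → u ≈ universal h₁ h₂ eq

  -- In IsPullback p q f g the cone is (p , q) and the cospan (f , g):
  --
  --        p
  --    P ----> A
  --  q |       | f
  --    v       v
  --    B ----> C
  --        g
  record IsPullback {P A B C} (p : P ⇒ A) (q : P ⇒ B)
                    (f : A ⇒ C) (g : B ⇒ C) : Set (o ⊔ ℓ ⊔ e) where
    field
      commute   : f ∘ p ≈ g ∘ q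
      universal : ∀ {X} (h₁ : X ⇒ A) (h₂ : X ⇒ B) → f ∘ h₁ ≈ g ∘ h₂ → X ⇒ P
      factor₁   : ∀ {X} {h₁ : X ⇒ A} {h₂ : X ⇒ B} (eq : f ∘ h₁ ≈ g ∘ h₂) →
                  p ∘ universal h₁ h₂ eq ≈ h₁
      factor₂   : ∀ {X} {h₁ : X ⇒ A} {h₂ : X ⇒ B} (eq : f ∘ h₁ ≈ g ∘ h₂) →
                  q ∘ universal h₁ h₂ eq ≈ h₂
      unique    : ∀ {X} {h₁ : X ⇒ A} {h₂ : X ⇒ B} (eq : f ∘ h₁ ≈ g ∘ h₂) {u : X ⇒ P} →
                  p ∘ u ≈ h₁ → q ∘ u ≈ h₂ → u ≈ universal h₁ h₂ eq

  HasPushout : ∀ {A B C} → A ⇒ B → A ⇒ C → Set (o ⊔ ℓ ⊔ e)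
  HasPushout {A} {B} {C} f g =
    ∃ λ D → Σ (B ⇒ D) λ p → Σ (C ⇒ D) λ q → IsPushout f g p q

  HasPullback : ∀ {A B C} → A ⇒ C → B ⇒ C → Set (o ⊔ ℓ ⊔ e)
  HasPullback {A} {B} {C} f g =
    ∃ λ P → Σ (P ⇒ A) λ p → Σ (P ⇒ B) λ q → IsPullback p q f g

  record Coproduct (A B : Obj) : Set (o ⊔ ℓ ⊔ e) where
    field
      A+B     : Obj
      ι₁      : A ⇒ A+B
      ι₂      : B ⇒ A+B
      [_,_]   : ∀ {X} → A ⇒ X → B ⇒ X → A+B ⇒ X
      inject₁ : ∀ {X} {f : A ⇒ X} {g : B ⇒ X} → [ f , g ] ∘ ι₁ ≈ f
      inject₂ : ∀ {X} {f : A ⇒ X} {g : B ⇒ X} → [ f , g ] ∘ ι₂ ≈ g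
      unique  : ∀ {X} {f : A ⇒ X} {g : B ⇒ X} {u : A+B ⇒ X} →
                u ∘ ι₁ ≈ f → u ∘ ι₂ ≈ g → u ≈ [ f , g ]

  -- The morphism f₁ + f₂ between two given coproducts.
  sum : ∀ {A₁ A₂ B₁ B₂} (P : Coproduct A₁ A₂) (Q : Coproduct B₁ B₂) →
        A₁ ⇒ B₁ → A₂ ⇒ B₂ → Coproduct.A+B P ⇒ Coproduct.A+B Q
  sum P Q f₁ f₂ = Coproduct.[_,_] P (Coproduct.ι₁ Q ∘ f₁) (Coproduct.ι₂ Q ∘ f₂)

  -- A class of morphisms must not distinguish equal morphisms, hence resp-≈.
  record MorphismClass (p : Level) : Set (o ⊔ ℓ ⊔ e ⊔ suc p) where
    field
      member : ∀ {A B} → A ⇒ B → Set p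
      resp-≈ : ∀ {A B} {f g : A ⇒ B} → f ≈ g → member f → member g

  infix 4 _∈_
  _∈_ : ∀ {p A B} → A ⇒ B → MorphismClass p → Set p
  f ∈ M = MorphismClass.member M f

  -- The bottom square has span (m , f) and cospan (g , n); the cube has top
  -- square A' B' C' D' and vertical morphisms a, b, c, d.
  IsWeakVanKampen : ∀ {p} (M : MorphismClass p) {A B C D}
                    (m : A ⇒ B) (f : A ⇒ C) (g : B ⇒ D) (n : C ⇒ D) →
                    Set (o ⊔ ℓ ⊔ e ⊔ p)
  IsWeakVanKampen M {A} {B} {C} {D} m f g n =
    ∀ {A' B' C' D'}
      (m' : A' ⇒ B') (f' : A' ⇒ C') (g' : B' ⇒ D') (n' : C' ⇒ D')
      (a : A' ⇒ A) (b : B' ⇒ B) (c : C' ⇒ C) (d : D' ⇒ D) →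
      g' ∘ m' ≈ n' ∘ f' →
      d ∘ g' ≈ g ∘ b →
      d ∘ n' ≈ n ∘ c →
      IsPullback m' a b m →
      IsPullback f' a c f →
      (f ∈ M) ⊎ ((b ∈ M) × (c ∈ M) × (d ∈ M)) →
      IsPushout m' f' g' n' ⇔ (IsPullback g' b d g × IsPullback n' c d n)

  record IsWeakAdhesiveHLR {p} (M : MorphismClass p) : Set (o ⊔ ℓ ⊔ e ⊔ p) where
    field
      M-mono      : ∀ {A B} {f : A ⇒ B} → f ∈ M → Mono f
      M-iso       : ∀ {A B} {f : A ⇒ B} → IsIso f → f ∈ M
      M-compose   : ∀ {A B C} {f : A ⇒ B} {g : B ⇒ C} → f ∈ M → g ∈ M → g ∘ f ∈ M
      M-decompose : ∀ {A B C} {f : A ⇒ B} {g : B ⇒ C} → g ∘ f ∈ M → g ∈ M → f ∈ M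
      pushouts    : ∀ {A B C} (m : A ⇒ B) (f : A ⇒ C) → m ∈ M → HasPushout m f
      pullbacks   : ∀ {A B C} (m : A ⇒ C) (f : B ⇒ C) → m ∈ M → HasPullback m f
      M-pushout   : ∀ {A B C D} {m : A ⇒ B} {f : A ⇒ C} {g : B ⇒ D} {n : C ⇒ D} →
                    IsPushout m f g n → m ∈ M → n ∈ M
      M-pullback  : ∀ {P A B C} {p : P ⇒ A} {q : P ⇒ B} {m : A ⇒ C} {f : B ⇒ C} →
                    IsPullback p q m f → m ∈ M → q ∈ M
      vanKampen   : ∀ {A B C D} {m : A ⇒ B} {f : A ⇒ C} {g : B ⇒ D} {n : C ⇒ D} →
                    m ∈ M → IsPushout m f g n → IsWeakVanKampen M m f g n

  record WeakSpan : Set (o ⊔ ℓ) where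
    field
      {L K I R} : Obj
      l : K ⇒ L
      i : I ⇒ K
      r : I ⇒ R

  IsMWeakSpan : ∀ {p} → MorphismClass p → WeakSpan → Set p
  IsMWeakSpan M ρ = (l ∈ M) × (i ∈ M) × (r ∈ M)
    where open WeakSpan ρ

  -- A direct transformation of G by ρ with result H.  The set Δ(G,ρ) is the
  -- union over all objects H.
  record DirectTransformation (G : Obj) (ρ : WeakSpan) (H : Obj) :
         Set (o ⊔ ℓ ⊔ e) where
    open WeakSpan ρ
    field
      {D} : Obj
      m : L ⇒ G
      k : K ⇒ D
      f : D ⇒ G
      g : D ⇒ H
      n : R ⇒ H
      pushoutG : IsPushout l k m f
      pushoutH : IsPushout r (k ∘ i) n g

  module _ {G : Obj} {ρ₁ ρ₂ : WeakSpan} {H₁ H₂ : Obj}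
           (γ₁ : DirectTransformation G ρ₁ H₁)
           (γ₂ : DirectTransformation G ρ₂ H₂) where

    private
      module ρ₁ = WeakSpan ρ₁
      module ρ₂ = WeakSpan ρ₂
      module γ₁ = DirectTransformation γ₁
      module γ₂ = DirectTransformation γ₂

    record ParallelIndependent : Set (ℓ ⊔ e) where
      field
        j₁ : ρ₁.L ⇒ γ₂.D
        j₂ : ρ₂.L ⇒ γ₁.D
        f₂∘j₁ : γ₂.f ∘ j₁ ≈ γ₁.m
        f₁∘j₂ : γ₁.f ∘ j₂ ≈ γ₂.m

    record ParallelCoherent : Set (ℓ ⊔ e) where
      field
        j₁² : ρ₁.I ⇒ γ₂.D
        j₂¹ : ρ₂.I ⇒ γ₁.D
        f₂∘j₁² : γ₂.f ∘ j₁² ≈ γ₁.f ∘ (γ₁.k ∘ ρ₁.i)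
        f₁∘j₂¹ : γ₁.f ∘ j₂¹ ≈ γ₂.f ∘ (γ₂.k ∘ ρ₂.i)

    -- The equations on d₁ and d₂ determine them, by the uniqueness part of
    -- the pullback property.
    record ParallelCoherentTransformation (H' : Obj) : Set (o ⊔ ℓ ⊔ e) where
      field
        coherent : ParallelCoherent
      open ParallelCoherent coherent public
      field
        {D'} : Obj
        e₁ : D' ⇒ γ₁.D
        e₂ : D' ⇒ γ₂.D
        pullback : IsPullback e₁ e₂ γ₁.f γ₂.f

        d₁ : ρ₁.I ⇒ D'
        e₁∘d₁ : e₁ ∘ d₁ ≈ γ₁.k ∘ ρ₁.i
        e₂∘d₁ : e₂ ∘ d₁ ≈ j₁²
        d₂ : ρ₂.I ⇒ D'
        e₁∘d₂ : e₁ ∘ d₂ ≈ j₂¹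
        e₂∘d₂ : e₂ ∘ d₂ ≈ γ₂.k ∘ ρ₂.i

        {H'₁ H'₂} : Obj
        g'₁ : D' ⇒ H'₁
        n'₁ : ρ₁.R ⇒ H'₁
        pushout₁ : IsPushout ρ₁.r d₁ n'₁ g'₁
        g'₂ : D' ⇒ H'₂
        n'₂ : ρ₂.R ⇒ H'₂
        pushout₂ : IsPushout ρ₂.r d₂ n'₂ g'₂

        h₁ : H'₁ ⇒ H'
        h₂ : H'₂ ⇒ H'
        pushout : IsPushout g'₁ g'₂ h₁ h₂

  record WeakSpanCoproduct (ρ₁ ρ₂ : WeakSpan) : Set (o ⊔ ℓ ⊔ e) where
    private
      module ρ₁ = WeakSpan ρ₁
      module ρ₂ = WeakSpan ρ₂
    field
      L₁+L₂ : Coproduct ρ₁.L ρ₂.L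
      K₁+K₂ : Coproduct ρ₁.K ρ₂.K
      I₁+I₂ : Coproduct ρ₁.I ρ₂.I
      R₁+R₂ : Coproduct ρ₁.R ρ₂.R

    ρ₁+ρ₂ : WeakSpan
    ρ₁+ρ₂ = record
      { l = sum K₁+K₂ L₁+L₂ ρ₁.l ρ₂.l
      ; i = sum I₁+I₂ K₁+K₂ ρ₁.i ρ₂.i
      ; r = sum I₁+I₂ R₁+R₂ ρ₁.r ρ₂.r
      }

  -- A coproduct γ₁ + γ₂ with result H'.
  record TransformationCoproduct
         {ρ₁ ρ₂ : WeakSpan} (S : WeakSpanCoproduct ρ₁ ρ₂) {G H₁ H₂ : Obj}
         (γ₁ : DirectTransformation G ρ₁ H₁) (γ₂ : DirectTransformation G ρ₂ H₂)
         (H' : Obj) : Set (o ⊔ ℓ ⊔ e) where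
    open WeakSpanCoproduct S
    open Coproduct L₁+L₂ using ([_,_])
    field
      transformation : DirectTransformation G ρ₁+ρ₂ H'
      m-copairing    : DirectTransformation.m transformation
                       ≈ [ DirectTransformation.m γ₁ , DirectTransformation.m γ₂ ]

{-# OPTIONS --safe #-}

-- By parallel independence each K_a maps to the pullback D' of f₁ and f₂, and
-- the weak van Kampen property, applied to the cube over the pushout square
-- of γ₁ with verticals id, id, e₁, f₂ (and symmetrically for γ₂), shows that
-- D₂ is the pushout of L₁ and D' over K₁ and D₁ the pushout of L₂ and D' over
-- K₂.  Cancelling the first of these in the pushout square of γ₁ makes G the
-- pushout of D₂ and D₁ over D'.  Both G and H' are thus obtained by gluing over
-- D' two pushouts out of D', and such a gluing is one pushout of coproducts.
module Submission where

open import Data.Product using (_,_)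
open import Data.Sum using (inj₂)
open import Function.Bundles using (Equivalence)
open import Level using (Level)
open import Relation.Binary.Bundles using (Setoid)
open import Relation.Binary.Structures using (IsEquivalence)
import Relation.Binary.Reasoning.Setoid as SetoidReasoning
open import Defs

module _ {o ℓ e : Level} (𝒞 : Category o ℓ e) where
  open Category 𝒞

  hom-setoid : Obj → Obj → Setoid ℓ e
  hom-setoid A B = record { Carrier = A ⇒ B ; _≈_ = _≈_ ; isEquivalence = equiv }

  private
    module ≈ {A B : Obj} = IsEquivalence (equiv {A} {B})
    module Reasoning {A B : Obj} = SetoidReasoning (hom-setoid A B)
    open Reasoning

    variable
      A B C D E X : Obj

  -- Equational reasoning with composites.

  ∘-congˡ : {h : B ⇒ C} {f g : A ⇒ B} → f ≈ g → h ∘ f ≈ h ∘ g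
  ∘-congˡ = ∘-resp-≈ ≈.refl

  ∘-congʳ : {h : A ⇒ B} {f g : B ⇒ C} → f ≈ g → f ∘ h ≈ g ∘ h
  ∘-congʳ p = ∘-resp-≈ p ≈.refl

  pullʳ : {f : C ⇒ D} {g : B ⇒ C} {h : A ⇒ B} {k : A ⇒ C} →
          g ∘ h ≈ k → (f ∘ g) ∘ h ≈ f ∘ k
  pullʳ p = ≈.trans assoc (∘-congˡ p)

  pullˡ : {f : C ⇒ D} {g : B ⇒ C} {h : A ⇒ B} {k : B ⇒ D} →
          f ∘ g ≈ k → f ∘ (g ∘ h) ≈ k ∘ h
  pullˡ p = ≈.trans (≈.sym assoc) (∘-congʳ p)

  extendʳ : {f : B ⇒ D} {g : A ⇒ B} {h : C ⇒ D} {k : A ⇒ C} {x : D ⇒ E} →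
            f ∘ g ≈ h ∘ k → (x ∘ f) ∘ g ≈ (x ∘ h) ∘ k
  extendʳ p = ≈.trans (pullʳ p) (≈.sym assoc)

  id-mono : Mono 𝒞 (id {A})
  id-mono g h p = ≈.trans (≈.sym identityˡ) (≈.trans p identityˡ)

  id-isIso : IsIso 𝒞 (id {A})
  id-isIso = id , identityˡ , identityˡ

  IsPullback-swap : {p : X ⇒ A} {q : X ⇒ B} {f : A ⇒ C} {g : B ⇒ C} →
                    IsPullback 𝒞 p q f g → IsPullback 𝒞 q p g f
  IsPullback-swap pb = record
    { commute   = ≈.sym commute
    ; universal = λ h₁ h₂ eq → universal h₂ h₁ (≈.sym eq)
    ; factor₁   = λ eq → factor₂ (≈.sym eq)
    ; factor₂   = λ eq → factor₁ (≈.sym eq)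
    ; unique    = λ eq p q → unique (≈.sym eq) q p
    }
    where open IsPullback pb

  -- A cone over `m` and `g` is determined by its leg `h₂` into `A`: since `m` is mono, the other
  -- leg must be `p ∘ h₂`. This supplies the cube faces that have an identity as one vertical.
  mono⇒IsPullback-id : {p : A ⇒ B} {m : B ⇒ C} {g : A ⇒ C} →
                       Mono 𝒞 m → m ∘ p ≈ g → IsPullback 𝒞 p id m g
  mono⇒IsPullback-id {p = p} {m} {g} mono mp≈g = record
    { commute   = ≈.trans mp≈g (≈.sym identityʳ)
    ; universal = λ _ h₂ _ → h₂
    ; factor₁   = λ {_} {h₁} {h₂} eq → mono (p ∘ h₂) h₁ (begin
        m ∘ (p ∘ h₂) ≈⟨ pullˡ mp≈g ⟩
        g ∘ h₂       ≈⟨ eq ⟨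
        m ∘ h₁       ∎)
    ; factor₂   = λ _ → identityˡ
    ; unique    = λ _ _ q → ≈.trans (≈.sym identityˡ) q
    }

  -- Maps out of pushouts and coproducts; cancelling and gluing pushouts.

  IsPushout-jointly-epic : {f : A ⇒ B} {g : A ⇒ C} {p : B ⇒ D} {q : C ⇒ D} →
                           IsPushout 𝒞 f g p q → {u v : D ⇒ X} →
                           u ∘ p ≈ v ∘ p → u ∘ q ≈ v ∘ q → u ≈ v
  IsPushout-jointly-epic po {u} {v} up≈vp uq≈vq =
    ≈.trans (unique eq up≈vp uq≈vq) (≈.sym (unique eq ≈.refl ≈.refl))
    where
    open IsPushout po
    eq = extendʳ {x = v} commute

  Coproduct-jointly-epic : (P : Coproduct 𝒞 A B) {u v : Coproduct.A+B P ⇒ X} →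
                           u ∘ Coproduct.ι₁ P ≈ v ∘ Coproduct.ι₁ P →
                           u ∘ Coproduct.ι₂ P ≈ v ∘ Coproduct.ι₂ P → u ≈ v
  Coproduct-jointly-epic P p q =
    ≈.trans (unique p q) (≈.sym (unique ≈.refl ≈.refl))
    where open Coproduct P

  -- The outer square is the pasting of `left` with the square in question. A cocone `(h₁ , h₂)` on
  -- the latter becomes the cocone `(h₁ ∘ j , h₂)` on the outer one; that the mediating map
  -- restricts to `h₁` along `f'` is tested on the jointly epic pair `j`, `e'`.
  IsPushout-cancel :
    {l : A ⇒ B} {s : A ⇒ C} {j : B ⇒ D} {e' : C ⇒ D}
    {e₁ : C ⇒ E} {k : A ⇒ E} {f' : D ⇒ X} {m : B ⇒ X} {f : E ⇒ X} →
    IsPushout 𝒞 l s j e' → IsPushout 𝒞 l k m f →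
    e₁ ∘ s ≈ k → f' ∘ j ≈ m → f' ∘ e' ≈ f ∘ e₁ →
    IsPushout 𝒞 e' e₁ f' f
  IsPushout-cancel {l = l} {s} {j} {e'} {e₁} {k} {f'} {m} {f}
                   left outer es≈k f'j≈m f'e'≈fe = record
    { commute   = f'e'≈fe
    ; universal = λ h₁ h₂ eq → outer.universal (h₁ ∘ j) h₂ (outer-eq eq)
    ; factor₁   = λ {_} {h₁} {h₂} eq →
        let u = outer.universal (h₁ ∘ j) h₂ (outer-eq eq) in
        IsPushout-jointly-epic left
          (begin
            (u ∘ f') ∘ j  ≈⟨ pullʳ f'j≈m ⟩
            u ∘ m         ≈⟨ outer.factor₁ (outer-eq eq) ⟩
            h₁ ∘ j        ∎)
          (begin
            (u ∘ f') ∘ e' ≈⟨ extendʳ f'e'≈fe ⟩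
            (u ∘ f) ∘ e₁  ≈⟨ ∘-congʳ (outer.factor₂ (outer-eq eq)) ⟩
            h₂ ∘ e₁       ≈⟨ eq ⟨
            h₁ ∘ e'       ∎)
    ; factor₂   = λ eq → outer.factor₂ (outer-eq eq)
    ; unique    = λ {_} {h₁} {h₂} eq {u} uf'≈h₁ uf≈h₂ →
        outer.unique (outer-eq eq)
          (begin
            u ∘ m        ≈⟨ ∘-congˡ f'j≈m ⟨
            u ∘ (f' ∘ j) ≈⟨ pullˡ uf'≈h₁ ⟩
            h₁ ∘ j       ∎)
          uf≈h₂
    }
    where
    module left = IsPushout left
    module outer = IsPushout outer
    outer-eq : ∀ {Y} {h₁ : _ ⇒ Y} {h₂ : _ ⇒ Y} →
               h₁ ∘ e' ≈ h₂ ∘ e₁ → (h₁ ∘ j) ∘ l ≈ h₂ ∘ k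
    outer-eq {h₁ = h₁} {h₂} eq = begin
      (h₁ ∘ j) ∘ l  ≈⟨ extendʳ left.commute ⟩
      (h₁ ∘ e') ∘ s ≈⟨ ∘-congʳ eq ⟩
      (h₂ ∘ e₁) ∘ s ≈⟨ pullʳ es≈k ⟩
      h₂ ∘ k        ∎

  -- A map out of `E` is a pair of maps out of `C₁` and `C₂` agreeing on `D`, that is, maps out of
  -- `B₁`, `B₂` and `D` compatible over `A₁` and `A₂`. The leg `s` is given only by its
  -- restrictions, so that it may also be a composite such as `k ∘ i`.
  IsPushout-sum :
    ∀ {A₁ A₂ B₁ B₂ C₁ C₂} (P : Coproduct 𝒞 A₁ A₂) (Q : Coproduct 𝒞 B₁ B₂)
      {l₁ : A₁ ⇒ B₁} {l₂ : A₂ ⇒ B₂} {s₁ : A₁ ⇒ D} {s₂ : A₂ ⇒ D}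
      {p₁ : B₁ ⇒ C₁} {q₁ : D ⇒ C₁} {p₂ : B₂ ⇒ C₂} {q₂ : D ⇒ C₂}
      {h₁ : C₁ ⇒ E} {h₂ : C₂ ⇒ E} {s : Coproduct.A+B P ⇒ D} →
    IsPushout 𝒞 l₁ s₁ p₁ q₁ → IsPushout 𝒞 l₂ s₂ p₂ q₂ → IsPushout 𝒞 q₁ q₂ h₁ h₂ →
    s ∘ Coproduct.ι₁ P ≈ s₁ → s ∘ Coproduct.ι₂ P ≈ s₂ →
    IsPushout 𝒞 (sum 𝒞 P Q l₁ l₂) s
              (Coproduct.[_,_] Q (h₁ ∘ p₁) (h₂ ∘ p₂)) (h₁ ∘ q₁)
  IsPushout-sum P Q {l₁} {l₂} {s₁} {s₂} {p₁} {q₁} {p₂} {q₂} {h₁} {h₂} {s}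
                po₁ po₂ po sι₁≈s₁ sι₂≈s₂ = record
    { commute   = Coproduct-jointly-epic P
        (begin
          (m ∘ l) ∘ P.ι₁         ≈⟨ extendʳ P.inject₁ ⟩
          (m ∘ Q.ι₁) ∘ l₁        ≈⟨ ∘-congʳ Q.inject₁ ⟩
          (h₁ ∘ p₁) ∘ l₁         ≈⟨ extendʳ po₁.commute ⟩
          (h₁ ∘ q₁) ∘ s₁         ≈⟨ pullʳ sι₁≈s₁ ⟨
          ((h₁ ∘ q₁) ∘ s) ∘ P.ι₁ ∎)
        (begin
          (m ∘ l) ∘ P.ι₂         ≈⟨ extendʳ P.inject₂ ⟩
          (m ∘ Q.ι₂) ∘ l₂        ≈⟨ ∘-congʳ Q.inject₂ ⟩
          (h₂ ∘ p₂) ∘ l₂         ≈⟨ extendʳ po₂.commute ⟩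
          (h₂ ∘ q₂) ∘ s₂         ≈⟨ ∘-congʳ po.commute ⟨
          (h₁ ∘ q₁) ∘ s₂         ≈⟨ pullʳ sι₂≈s₂ ⟨
          ((h₁ ∘ q₁) ∘ s) ∘ P.ι₂ ∎)
    ; universal = λ x y eq → Mediating.u x y eq
    ; factor₁   = λ {_} {x} {y} eq → let open Mediating x y eq in
        Coproduct-jointly-epic Q
          (begin
            (u ∘ m) ∘ Q.ι₁ ≈⟨ pullʳ Q.inject₁ ⟩
            u ∘ (h₁ ∘ p₁)  ≈⟨ pullˡ (po.factor₁ u-eq) ⟩
            u₁ ∘ p₁        ≈⟨ po₁.factor₁ eq₁ ⟩
            x ∘ Q.ι₁       ∎)
          (begin
            (u ∘ m) ∘ Q.ι₂ ≈⟨ pullʳ Q.inject₂ ⟩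
            u ∘ (h₂ ∘ p₂)  ≈⟨ pullˡ (po.factor₂ u-eq) ⟩
            u₂ ∘ p₂        ≈⟨ po₂.factor₁ eq₂ ⟩
            x ∘ Q.ι₂       ∎)
    ; factor₂   = λ {_} {x} {y} eq → let open Mediating x y eq in begin
        u ∘ (h₁ ∘ q₁) ≈⟨ pullˡ (po.factor₁ u-eq) ⟩
        u₁ ∘ q₁       ≈⟨ po₁.factor₂ eq₁ ⟩
        y             ∎
    ; unique    = λ {_} {x} {y} eq {v} vm≈x vhq≈y → let open Mediating x y eq in
        po.unique u-eq
          (po₁.unique eq₁
            (begin
              (v ∘ h₁) ∘ p₁  ≈⟨ pullʳ (≈.sym Q.inject₁) ⟩
              v ∘ (m ∘ Q.ι₁) ≈⟨ pullˡ vm≈x ⟩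
              x ∘ Q.ι₁       ∎)
            (≈.trans assoc vhq≈y))
          (po₂.unique eq₂
            (begin
              (v ∘ h₂) ∘ p₂  ≈⟨ pullʳ (≈.sym Q.inject₂) ⟩
              v ∘ (m ∘ Q.ι₂) ≈⟨ pullˡ vm≈x ⟩
              x ∘ Q.ι₂       ∎)
            (begin
              (v ∘ h₂) ∘ q₂  ≈⟨ pullʳ (≈.sym po.commute) ⟩
              v ∘ (h₁ ∘ q₁)  ≈⟨ vhq≈y ⟩
              y              ∎))
    }
    where
    module P = Coproduct P
    module Q = Coproduct Q
    module po₁ = IsPushout po₁
    module po₂ = IsPushout po₂
    module po = IsPushout po
    l = sum 𝒞 P Q l₁ l₂
    m = Q.[ h₁ ∘ p₁ , h₂ ∘ p₂ ]

    -- Restricting along the injections splits the cocone into one for each small pushout. Both have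
    -- the leg `y` on `D`, so `u₁` and `u₂` glue.
    module Mediating {Y} (x : Q.A+B ⇒ Y) (y : _ ⇒ Y) (eq : x ∘ l ≈ y ∘ s) where
      eq₁ : (x ∘ Q.ι₁) ∘ l₁ ≈ y ∘ s₁
      eq₁ = begin
        (x ∘ Q.ι₁) ∘ l₁ ≈⟨ extendʳ P.inject₁ ⟨
        (x ∘ l) ∘ P.ι₁  ≈⟨ ∘-congʳ eq ⟩
        (y ∘ s) ∘ P.ι₁  ≈⟨ pullʳ sι₁≈s₁ ⟩
        y ∘ s₁          ∎

      eq₂ : (x ∘ Q.ι₂) ∘ l₂ ≈ y ∘ s₂
      eq₂ = begin
        (x ∘ Q.ι₂) ∘ l₂ ≈⟨ extendʳ P.inject₂ ⟨
        (x ∘ l) ∘ P.ι₂  ≈⟨ ∘-congʳ eq ⟩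
        (y ∘ s) ∘ P.ι₂  ≈⟨ pullʳ sι₂≈s₂ ⟩
        y ∘ s₂          ∎

      u₁ = po₁.universal (x ∘ Q.ι₁) y eq₁
      u₂ = po₂.universal (x ∘ Q.ι₂) y eq₂

      u-eq : u₁ ∘ q₁ ≈ u₂ ∘ q₂
      u-eq = ≈.trans (po₁.factor₂ eq₁) (≈.sym (po₂.factor₂ eq₂))

      u = po.universal u₁ u₂ u-eq

  -- Pulling back a pushout square along an `M`-morphism.

  module _ {p} {M : MorphismClass 𝒞 p} (hlr : IsWeakAdhesiveHLR 𝒞 M) where
    open IsWeakAdhesiveHLR hlr

    -- Since `m` factors through the mono `f'` as `f' ∘ j`, pulling `m` back along `f'` leaves `B`
    -- unchanged. Both front faces of the cube are then pullbacks, so its top face is a pushout.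
    IsPushout-restrict :
      {l : A ⇒ B} {k : A ⇒ C} {m : B ⇒ D} {f : C ⇒ D}
      {e' : X ⇒ E} {e₁ : X ⇒ C} {f' : E ⇒ D} {s : A ⇒ X} {j : B ⇒ E} →
      _∈_ 𝒞 l M → IsPushout 𝒞 l k m f →
      _∈_ 𝒞 f' M → IsPullback 𝒞 e' e₁ f' f →
      f' ∘ j ≈ m → j ∘ l ≈ e' ∘ s → e₁ ∘ s ≈ k →
      IsPushout 𝒞 l s j e'
    IsPushout-restrict {l = l} {e' = e'} {e₁} {f'} {s} {j} l∈M po f'∈M pb f'j≈m jl≈e's es≈k =
      Equivalence.from
        (vanKampen l∈M po l s j e' id id e₁ f' jl≈e's
          (≈.trans f'j≈m (≈.sym identityʳ))
          (IsPullback.commute pb)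
          (mono⇒IsPullback-id id-mono identityˡ)
          (mono⇒IsPullback-id (M-mono e∈M) es≈k)
          -- `k` is not assumed to lie in `M`, so the condition is met by the verticals: `e₁` lies
          -- in `M` as a pullback of `f'`.
          (inj₂ (M-iso id-isIso , e∈M , f'∈M)))
        (mono⇒IsPullback-id (M-mono f'∈M) f'j≈m , pb)
      where e∈M = M-pullback pb f'∈M

theorem4p5 : ∀ {o ℓ e p} (𝒞 : Category o ℓ e) (M : MorphismClass 𝒞 p) →
    IsWeakAdhesiveHLR 𝒞 M →
    (ρ₁ ρ₂ : WeakSpan 𝒞) → IsMWeakSpan 𝒞 M ρ₁ → IsMWeakSpan 𝒞 M ρ₂ →
    (S : WeakSpanCoproduct 𝒞 ρ₁ ρ₂) →
    (G H' : Category.Obj 𝒞) {H₁ H₂ : Category.Obj 𝒞}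
    (γ₁ : DirectTransformation 𝒞 G ρ₁ H₁) (γ₂ : DirectTransformation 𝒞 G ρ₂ H₂) →
    ParallelIndependent 𝒞 γ₁ γ₂ →
    ParallelCoherentTransformation 𝒞 γ₁ γ₂ H' →
    TransformationCoproduct 𝒞 S γ₁ γ₂ H'
theorem4p5 𝒞 M hlr ρ₁ ρ₂ (l₁∈M , _) (l₂∈M , _) S G H' γ₁ γ₂ ind pct = record
  { transformation = record
    -- The components are `m₁` and `m₂` factored through `D₂` and `D₁`, the form that the gluing of
    -- pushouts produces; `m-copairing` converts it.
    { m        = L.[ γ₂.f ∘ j₁ , γ₁.f ∘ j₂ ]
    ; k        = k
    ; f        = γ₂.f ∘ e₂
    ; g        = h₁ ∘ g'₁
    ; n        = R.[ h₁ ∘ n'₁ , h₂ ∘ n'₂ ]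
    ; pushoutG = IsPushout-sum 𝒞 K₁+K₂ L₁+L₂ D₂-pushout D₁-pushout G-pushout
                   K.inject₁ K.inject₂
    ; pushoutH = IsPushout-sum 𝒞 I₁+I₂ R₁+R₂ pushout₁ pushout₂ pushout ki∘ι₁ ki∘ι₂
    }
  ; m-copairing = L.unique (≈.trans L.inject₁ f₂∘j₁) (≈.trans L.inject₂ f₁∘j₂)
  }
  where
  open Category 𝒞
  module ≈ {A B} = IsEquivalence (equiv {A} {B})
  module Reasoning {A B} = SetoidReasoning (hom-setoid 𝒞 A B)
  open Reasoning
  open IsWeakAdhesiveHLR hlr
  module ρ₁ = WeakSpan ρ₁
  module ρ₂ = WeakSpan ρ₂
  module γ₁ = DirectTransformation γ₁
  module γ₂ = DirectTransformation γ₂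
  open ParallelIndependent ind
  open ParallelCoherentTransformation pct
  open WeakSpanCoproduct S
  module L = Coproduct L₁+L₂
  module K = Coproduct K₁+K₂
  module I = Coproduct I₁+I₂
  module R = Coproduct R₁+R₂
  module PB = IsPullback pullback
  i = sum 𝒞 I₁+I₂ K₁+K₂ ρ₁.i ρ₂.i

  f₁∈M = M-pushout γ₁.pushoutG l₁∈M
  f₂∈M = M-pushout γ₂.pushoutG l₂∈M
  -- The indices cross: `e₁` is a pullback of `γ₂.f`, and `e₂` of `γ₁.f`.
  e₁-mono = M-mono (M-pullback (IsPullback-swap 𝒞 pullback) f₂∈M)
  e₂-mono = M-mono (M-pullback pullback f₁∈M)

  s₁-eq : γ₁.f ∘ γ₁.k ≈ γ₂.f ∘ (j₁ ∘ ρ₁.l)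
  s₁-eq = ≈.trans (≈.sym (IsPushout.commute γ₁.pushoutG)) (≈.sym (pullˡ 𝒞 f₂∘j₁))

  s₂-eq : γ₁.f ∘ (j₂ ∘ ρ₂.l) ≈ γ₂.f ∘ γ₂.k
  s₂-eq = ≈.trans (pullˡ 𝒞 f₁∘j₂) (IsPushout.commute γ₂.pushoutG)

  -- Coherence gives maps to `D'` only from the interfaces `I`; the independence morphism `j₁`
  -- extends this to all of `K₁`, through `j₁ ∘ ρ₁.l` into `D₂`.
  s₁ : ρ₁.K ⇒ D'
  s₁ = PB.universal γ₁.k (j₁ ∘ ρ₁.l) s₁-eq

  s₂ : ρ₂.K ⇒ D'
  s₂ = PB.universal (j₂ ∘ ρ₂.l) γ₂.k s₂-eq

  k : K.A+B ⇒ D'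
  k = K.[ s₁ , s₂ ]

  D₂-pushout : IsPushout 𝒞 ρ₁.l s₁ j₁ e₂
  D₂-pushout = IsPushout-restrict 𝒞 hlr l₁∈M γ₁.pushoutG f₂∈M
    (IsPullback-swap 𝒞 pullback) f₂∘j₁ (≈.sym (PB.factor₂ s₁-eq)) (PB.factor₁ s₁-eq)

  D₁-pushout : IsPushout 𝒞 ρ₂.l s₂ j₂ e₁
  D₁-pushout = IsPushout-restrict 𝒞 hlr l₂∈M γ₂.pushoutG f₁∈M
    pullback f₁∘j₂ (≈.sym (PB.factor₁ s₂-eq)) (PB.factor₂ s₂-eq)

  G-pushout : IsPushout 𝒞 e₂ e₁ γ₂.f γ₁.f
  G-pushout = IsPushout-cancel 𝒞 D₂-pushout γ₁.pushoutG
    (PB.factor₁ s₁-eq) f₂∘j₁ (≈.sym PB.commute)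

  -- Testing after the mono `e₁` suffices, where both sides become `γ₁.k ∘ ρ₁.i`; this avoids
  -- comparing `j₁²` with `j₁`. For `d₂` the same role falls to `e₂`.
  ki∘ι₁ : (k ∘ i) ∘ I.ι₁ ≈ d₁
  ki∘ι₁ = e₁-mono _ _ (begin
    e₁ ∘ ((k ∘ i) ∘ I.ι₁)    ≈⟨ ∘-congˡ 𝒞 (extendʳ 𝒞 I.inject₁) ⟩
    e₁ ∘ ((k ∘ K.ι₁) ∘ ρ₁.i) ≈⟨ ∘-congˡ 𝒞 (∘-congʳ 𝒞 K.inject₁) ⟩
    e₁ ∘ (s₁ ∘ ρ₁.i)         ≈⟨ pullˡ 𝒞 (PB.factor₁ s₁-eq) ⟩
    γ₁.k ∘ ρ₁.i              ≈⟨ e₁∘d₁ ⟨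
    e₁ ∘ d₁                  ∎)

  ki∘ι₂ : (k ∘ i) ∘ I.ι₂ ≈ d₂
  ki∘ι₂ = e₂-mono _ _ (begin
    e₂ ∘ ((k ∘ i) ∘ I.ι₂)    ≈⟨ ∘-congˡ 𝒞 (extendʳ 𝒞 I.inject₂) ⟩
    e₂ ∘ ((k ∘ K.ι₂) ∘ ρ₂.i) ≈⟨ ∘-congˡ 𝒞 (∘-congʳ 𝒞 K.inject₂) ⟩
    e₂ ∘ (s₂ ∘ ρ₂.i)         ≈⟨ pullˡ 𝒞 (PB.factor₂ s₂-eq) ⟩
    γ₂.k ∘ ρ₂.i              ≈⟨ e₂∘d₂ ⟨
    e₂ ∘ d₂                  ∎)
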